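{- Let $p$ be a prime, let $d, w_1, w_2 \in \mathbb{N}$, let $\chi$ be a Dirichlet character with conductor $d$ (with values in $\mathbb{C}_p$), and let $\xi \in T_p$. For all $n \in \mathbb{Z}_+$, $m \in \mathbb{N}$ and all $x,y\in\mathbb{C}_p$, $$\sum_{k=0}^{n}\binom{n}{k}w_1^{k-1} w_2^{n-k}B_{n-k,\chi,\xi^{w_2}}^{(m-1)}(w_1y)\sum_{i=0}^{w_1d-1}\chi(i)\xi^{w_2 i}B_{k,\chi,\xi^{w_1}}^{(m)}\!\left(w_2x+\frac{w_2}{w_1}i\right)$$ $$=\sum_{k=0}^{n}\binom{n}{k}w_2^{k-1} w_1^{n-k}B_{n-k,\chi,\xi^{w_1}}^{(m-1)}(w_2y)\sum_{i=0}^{w_2d-1}\chi(i)\xi^{w_1 i}B_{k,\chi,\xi^{w_2}}^{(m)}\!\left(w_1x+\frac{w_1}{w_2}i\right).$$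
   Context: $\mathbb{N}=\{1,2,3,\dots\}$ and $\mathbb{Z}_+=\mathbb{N}\cup\{0\}$. $\mathbb{C}_p$ is the completion of an algebraic closure of $\mathbb{Q}_p$. $T_p=\bigcup_{n\ge 1}\{\omega\in\mathbb{C}_p : \omega^{p^n}=1\}$ is the group of $p$-power roots of unity. For $\xi\in T_p$, a Dirichlet character $\chi$ with conductor $d$, and an integer $k\ge 0$, the generalized twisted Bernoulli polynomials of order $k$ attached to $\chi$, $B_{n,\chi,\xi}^{(k)}(x)$, are defined by the identity of formal power series in $t$ $$\left(\frac{t\sum_{a=0}^{d-1}\chi(a)\xi^a e^{at}}{\xi^d e^{dt}-1}\right)^k e^{xt}=\sum_{n=0}^{\infty}B_{n,\chi,\xi}^{(k)}(x)\frac{t^n}{n!}$$ (so for $k=0$ one has $B_{n,\chi,\xi}^{(0)}(x)=x^n$, with $0^0=1$). -}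

module Defs where

open import Algebra.Apartness.Bundles using (HeytingField)
open import Algebra.Bundles using (CommutativeRing)
open import Algebra.Morphism.Structures using (module RingMorphisms)
import Algebra.Apartness.Properties.HeytingCommutativeRing as HeytingProperties
import Algebra.Properties.Ring as RingProperties
import Algebra.Properties.Semiring.Exp as Exp
import Algebra.Properties.Semiring.Mult as Mult
import Algebra.Properties.Semiring.Sum as Sum
open import Data.Empty using (⊥-elim)
open import Data.Fin.Base using (Fin; toℕ)
open import Data.Integer.Base using (ℤ; +_; -[1+_])
import Data.Integer.Base as ℤ
open import Data.Integer.Coprimality using (Coprime)
open import Data.Integer.Divisibility using (_∣_)
open import Data.Nat.Base using (ℕ; zero; suc; NonZero; _∸_; _!)
import Data.Nat.Base as ℕ
import Data.Nat.Coprimality as ℕ using (Coprime)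
import Data.Nat.Divisibility as ℕ using (_∣_)
import Data.Nat.Properties as ℕ
open import Data.Nat.Primality using (Prime; prime⇒nonZero)
open import Data.Product.Base using (∃-syntax; Σ-syntax; _×_; _,_; proj₁; proj₂)
open import Data.Rational.Base using (ℚ; 0ℚ; 1ℚ; _/_; _⊓_)
import Data.Rational.Base as ℚ
import Data.Rational.Properties as ℚ
open import Data.Sum.Base using (_⊎_; inj₁; inj₂; [_,_]′)
open import Level using (Level; _⊔_) renaming (suc to lsuc)
open import Relation.Binary.PropositionalEquality.Core as ≡ using (_≡_)
import Relation.Binary.Reasoning.Setoid as ≈-Reasoning
open import Relation.Nullary.Negation using (¬_)

private
  variable
    a b b₁ b₂ c ℓ₁ ℓ₂ : Level

module FieldNotation (K : HeytingField c ℓ₁ ℓ₂) where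

  open HeytingField K public

  ring-K : CommutativeRing c ℓ₁
  ring-K = record { isCommutativeRing = isCommutativeRing }

  open CommutativeRing ring-K public using (semiring; ring; rawRing)
  open HeytingProperties heytingCommutativeRing public
  open Exp semiring public using (_^_)
  open Mult semiring public using () renaming (_×_ to _·_)
  open Sum semiring public using (sum; sum-syntax; sum⁺-syntax)

  ⟦_⟧ : ℕ → Carrier
  ⟦ n ⟧ = n · 1#

  _⁻¹[_] : (x : Carrier) → x # 0# → Carrier
  x ⁻¹[ x#0 ] = proj₁ (#⇒invertible x#0)

  x*x⁻¹≈1 : ∀ {x} (x#0 : x # 0#) → x * x ⁻¹[ x#0 ] ≈ 1#
  x*x⁻¹≈1 {x} x#0 =
    trans (*-congʳ (sym (x-0≈x x))) (proj₂ (proj₂ (#⇒invertible x#0)))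

  unit⇒#0 : ∀ {x y} → x * y ≈ 1# → x # 0#
  unit⇒#0 {x} {y} xy≈1 = invertibleʳ⇒# (y , trans (*-congʳ (x-0≈x x)) xy≈1)

  -- The value at x of the monic polynomial Xⁿ + aₙ₋₁Xⁿ⁻¹ + … + a₀.
  evalMonic : ∀ {n} → (Fin n → Carrier) → Carrier → Carrier
  evalMonic {n} coeff x = x ^ n + (∑[ i < n ] (coeff i * x ^ toℕ i))

CharacteristicZero : HeytingField c ℓ₁ ℓ₂ → Set ℓ₂
CharacteristicZero K = ∀ n → .{{NonZero n}} → ⟦ n ⟧ # 0#
  where open FieldNotation K

IsFieldHomomorphism : (K : HeytingField a b b₁) (L : HeytingField c ℓ₁ ℓ₂) →
  (HeytingField.Carrier K → HeytingField.Carrier L) → Set (a ⊔ b ⊔ ℓ₁)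
IsFieldHomomorphism K L =
  RingMorphisms.IsRingHomomorphism
    (FieldNotation.rawRing K) (FieldNotation.rawRing L)

-- A rank-one valuation with values in ℚ ∪ {∞}, written additively: it stands
-- for the absolute value |x| = p^(-v x).  The value v 0 = ∞ is left implicit.
record Valuation (K : HeytingField c ℓ₁ ℓ₂) : Set (c ⊔ ℓ₁ ⊔ ℓ₂) where
  open FieldNotation K
  field
    v      : ∀ {x} → x # 0# → ℚ
    v-cong : ∀ {x y} (x#0 : x # 0#) (y#0 : y # 0#) → x ≈ y → v x#0 ≡ v y#0
    v-*    : ∀ {x y} (x#0 : x # 0#) (y#0 : y # 0#) (xy#0 : x * y # 0#) →
             v xy#0 ≡ v x#0 ℚ.+ v y#0
    v-+    : ∀ {x y} (x#0 : x # 0#) (y#0 : y # 0#) (x+y#0 : x + y # 0#) →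
             v x#0 ⊓ v y#0 ℚ.≤ v x+y#0

  -- v (x - y) ≥ q, which includes the case x ≈ y.
  Close : ℚ → Carrier → Carrier → Set ℓ₂
  Close q x y = (x-y#0 : x - y # 0#) → q ℚ.≤ v x-y#0

  Cauchy : (ℕ → Carrier) → Set ℓ₂
  Cauchy s = ∀ q → ∃[ N ] (∀ m n → N ℕ.≤ m → N ℕ.≤ n → Close q (s m) (s n))

  _⟶_ : (ℕ → Carrier) → Carrier → Set ℓ₂
  s ⟶ x = ∀ q → ∃[ N ] (∀ n → N ℕ.≤ n → Close q (s n) x)

  Complete : Set (c ⊔ ℓ₂)
  Complete = ∀ s → Cauchy s → ∃[ x ] (s ⟶ x)

record ValuedField c ℓ₁ ℓ₂ : Set (lsuc (c ⊔ ℓ₁ ⊔ ℓ₂)) where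
  field
    heytingField : HeytingField c ℓ₁ ℓ₂
    valuation    : Valuation heytingField
  open FieldNotation heytingField public
  open Valuation valuation public

Extends : {K : HeytingField a b b₁} {L : HeytingField c ℓ₁ ℓ₂} →
  Valuation K → Valuation L →
  (HeytingField.Carrier K → HeytingField.Carrier L) → Set (a ⊔ b₁ ⊔ ℓ₂)
Extends {K = K} {L = L} V W ι =
  ∀ {x} (x#0 : x K.# K.0#) (ιx#0 : ι x L.# L.0#) → W.v ιx#0 ≡ V.v x#0
  where
  module K = HeytingField K
  module L = HeytingField L
  module V = Valuation V
  module W = Valuation W

record Completion (K : ValuedField a b b₁) c ℓ₁ ℓ₂ :
  Set (a ⊔ b ⊔ b₁ ⊔ lsuc (c ⊔ ℓ₁ ⊔ ℓ₂)) where
  private module K = ValuedField K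
  field
    completed      : ValuedField c ℓ₁ ℓ₂
  private module L = ValuedField completed
  field
    ι              : K.Carrier → L.Carrier
    ι-homomorphism : IsFieldHomomorphism K.heytingField L.heytingField ι
    ι-isometry     : Extends K.valuation L.valuation ι
    dense          : ∀ x q → ∃[ z ] L.Close q (ι z) x
    complete       : L.Complete

record AlgebraicClosure (K : HeytingField a b b₁) c ℓ₁ ℓ₂ :
  Set (a ⊔ b ⊔ b₁ ⊔ lsuc (c ⊔ ℓ₁ ⊔ ℓ₂)) where
  private module K = FieldNotation K
  field
    closure        : HeytingField c ℓ₁ ℓ₂
  private module L = FieldNotation closure
  field
    ι              : K.Carrier → L.Carrier
    ι-homomorphism : IsFieldHomomorphism K closure ι
    algebraic      : ∀ x → ∃[ n ] Σ[ coeff ∈ (Fin n → K.Carrier) ]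
                       L.evalMonic (λ i → ι (coeff i)) x L.≈ L.0#
    closed         : ∀ n (coeff : Fin (suc n) → L.Carrier) →
                       ∃[ x ] L.evalMonic coeff x L.≈ L.0#

-- These two conditions determine the p-adic valuation on ℚ when p is prime.
record IsPAdic (p : ℕ) (V : Valuation ℚ.heytingField) : Set where
  open Valuation V
  open HeytingField ℚ.heytingField using (_#_)
  field
    v-p       : (p#0 : + p / 1 # 0ℚ) → v p#0 ≡ 1ℚ
    v-coprime : ∀ n → ℕ.Coprime n p → (n#0 : + n / 1 # 0ℚ) → v n#0 ≡ 0ℚ

-- A model of ℂₚ, with ℚ ⊂ ℚₚ ⊂ ℚ̄ₚ ⊂ ℂₚ; it is unique up to isomorphism.
record ComplexPAdicNumbers (p : ℕ) c ℓ₁ ℓ₂ : Set (lsuc (c ⊔ ℓ₁ ⊔ ℓ₂)) where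
  field
    ℚ-valuation : Valuation ℚ.heytingField
    ℚ-isPAdic   : IsPAdic p ℚ-valuation
    ℚₚ          : Completion
                    (record { heytingField = ℚ.heytingField
                            ; valuation    = ℚ-valuation }) c ℓ₁ ℓ₂
  module ℚₚ = Completion ℚₚ
  field
    ℚ̄ₚ          : AlgebraicClosure (ValuedField.heytingField ℚₚ.completed) c ℓ₁ ℓ₂
  module ℚ̄ₚ = AlgebraicClosure ℚ̄ₚ
  field
    ℚ̄ₚ-valuation : Valuation ℚ̄ₚ.closure
    ℚ̄ₚ-extends   : Extends (ValuedField.valuation ℚₚ.completed) ℚ̄ₚ-valuation ℚ̄ₚ.ι
    ℂₚ           : Completion
                     (record { heytingField = ℚ̄ₚ.closure
                             ; valuation    = ℚ̄ₚ-valuation }) c ℓ₁ ℓ₂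
  module ℂₚ = Completion ℂₚ

  field-ℂₚ : HeytingField c ℓ₁ ℓ₂
  field-ℂₚ = ValuedField.heytingField ℂₚ.completed

characteristicZero-ℚ : CharacteristicZero ℚ.heytingField
characteristicZero-ℚ (suc n) eq =
  ℚ.<⇒≢ (ℚ.<-≤-trans 0<1 (1≤ n)) (≡.sym eq)
  where
  open FieldNotation ℚ.heytingField using (⟦_⟧)
  0<1 : 0ℚ ℚ.< 1ℚ
  0<1 = ℚ.positive⁻¹ 1ℚ
  0≤ : ∀ n → 0ℚ ℚ.≤ ⟦ n ⟧
  0≤ zero    = ℚ.≤-refl
  0≤ (suc n) = ℚ.+-mono-≤ (ℚ.<⇒≤ 0<1) (0≤ n)
  1≤ : ∀ n → 1ℚ ℚ.≤ ⟦ suc n ⟧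
  1≤ n = ℚ.+-mono-≤ (ℚ.≤-refl {1ℚ}) (0≤ n)

characteristicZero-transfer :
  (K : HeytingField a b b₁) (L : HeytingField c ℓ₁ ℓ₂) →
  ∀ {ι} → IsFieldHomomorphism K L ι →
  CharacteristicZero K → CharacteristicZero L
characteristicZero-transfer K L {ι} ι-hom charK n = L.unit⇒#0 (begin
  L.⟦ n ⟧ L.* ι u          ≈⟨ L.*-congʳ (ι-⟦⟧ n) ⟨
  ι K.⟦ n ⟧ L.* ι u        ≈⟨ *-homo _ _ ⟨
  ι (K.⟦ n ⟧ K.* u)        ≈⟨ ⟦⟧-cong (K.x*x⁻¹≈1 (charK n)) ⟩
  ι K.1#                   ≈⟨ 1#-homo ⟩
  L.1#                     ∎)
  where
  module K = FieldNotation K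
  module L = FieldNotation L
  open RingMorphisms.IsRingHomomorphism ι-hom
  open ≈-Reasoning L.setoid
  u : K.Carrier
  u = K.⟦ n ⟧ K.⁻¹[ charK n ]
  ι-⟦⟧ : ∀ n → ι K.⟦ n ⟧ L.≈ L.⟦ n ⟧
  ι-⟦⟧ zero    = 0#-homo
  ι-⟦⟧ (suc n) = L.trans (+-homo _ _) (L.+-cong 1#-homo (ι-⟦⟧ n))

characteristicZero-ℂₚ : ∀ {p} (C : ComplexPAdicNumbers p c ℓ₁ ℓ₂) →
  CharacteristicZero (ComplexPAdicNumbers.field-ℂₚ C)
characteristicZero-ℂₚ C =
  characteristicZero-transfer ℚ̄ₚ.closure field-ℂₚ ℂₚ.ι-homomorphism
    (characteristicZero-transfer ℚₚ-field ℚ̄ₚ.closure ℚ̄ₚ.ι-homomorphism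
      (characteristicZero-transfer ℚ.heytingField ℚₚ-field ℚₚ.ι-homomorphism
        characteristicZero-ℚ))
  where
  open ComplexPAdicNumbers C
  ℚₚ-field = ValuedField.heytingField ℚₚ.completed

module PowerSeries (K : HeytingField c ℓ₁ ℓ₂) (char0 : CharacteristicZero K) where

  open FieldNotation K public
  open RingProperties ring using (-‿anti-homo-+; +-cancelʳ; [y-z]x≈yx-zx)

  1/_ : (n : ℕ) → .{{NonZero n}} → Carrier
  1/ n = ⟦ n ⟧ ⁻¹[ char0 n ]

  infixr 8 _^ᶻ_
  _^ᶻ_ : (w : ℕ) → .{{NonZero w}} → ℤ → Carrier
  w ^ᶻ (+ n)    = ⟦ w ⟧ ^ n
  w ^ᶻ -[1+ n ] = (1/ w) ^ suc n

  -- f stands for Σₙ f(n) tⁿ.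
  Series : Set c
  Series = ℕ → Carrier

  infix 4 _≋_
  _≋_ : Series → Series → Set ℓ₁
  f ≋ g = ∀ n → f n ≈ g n

  infixl 7 _⊛_
  _⊛_ : Series → Series → Series
  (f ⊛ g) n = ∑[ k ≤ n ] (f (toℕ k) * g (n ∸ toℕ k))

  1ˢ : Series
  1ˢ zero    = 1#
  1ˢ (suc _) = 0#

  t∙_ : Series → Series
  (t∙ f) zero    = 0#
  (t∙ f) (suc n) = f n

  infixr 8 _^ˢ_
  _^ˢ_ : Series → ℕ → Series
  f ^ˢ zero  = 1ˢ
  f ^ˢ suc k = f ⊛ (f ^ˢ k)

  infix 9 _!⁻¹
  _!⁻¹ : ℕ → Carrier
  n !⁻¹ = (1/ (n !)) {{n ℕ.!≢0}}

  -- exp[ x ] is e^{xt}.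
  exp[_] : Carrier → Series
  exp[ x ] n = x ^ n * n !⁻¹

  -- Long division by a series with invertible constant term.
  divide : (f g : Series) → g 0 # 0# → Series
  divide f g g₀#0 zero    = f 0 * g 0 ⁻¹[ g₀#0 ]
  divide f g g₀#0 (suc n) =
    divide (λ j → f (suc j) - f 0 * g 0 ⁻¹[ g₀#0 ] * g (suc j)) g g₀#0 n

  divide-⊛ : ∀ f g (g₀#0 : g 0 # 0#) → divide f g g₀#0 ⊛ g ≋ f
  divide-⊛ f g g₀#0 zero = begin
    f 0 * u * g 0 + 0#   ≈⟨ +-identityʳ _ ⟩
    f 0 * u * g 0        ≈⟨ *-assoc _ _ _ ⟩
    f 0 * (u * g 0)      ≈⟨ *-congˡ (trans (*-comm _ _) (x*x⁻¹≈1 g₀#0)) ⟩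
    f 0 * 1#             ≈⟨ *-identityʳ _ ⟩
    f 0                  ∎
    where
    open ≈-Reasoning setoid
    u = g 0 ⁻¹[ g₀#0 ]
  divide-⊛ f g g₀#0 (suc n) = begin
    q + (divide f′ g g₀#0 ⊛ g) n   ≈⟨ +-congˡ (divide-⊛ f′ g g₀#0 n) ⟩
    q + (f (suc n) - q)            ≈⟨ +-comm _ _ ⟩
    f (suc n) - q + q              ≈⟨ +-assoc _ _ _ ⟩
    f (suc n) + (- q + q)          ≈⟨ +-congˡ (-‿inverseˡ q) ⟩
    f (suc n) + 0#                 ≈⟨ +-identityʳ _ ⟩
    f (suc n)                      ∎
    where
    open ≈-Reasoning setoid
    q  = f 0 * g 0 ⁻¹[ g₀#0 ] * g (suc n)
    f′ = λ j → f (suc j) - f 0 * g 0 ⁻¹[ g₀#0 ] * g (suc j)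

  shift : ∀ f g → g 0 ≈ 0# → f ⊛ g ≋ t∙ (f ⊛ (λ n → g (suc n)))
  shift f g g₀≈0 zero = trans (+-identityʳ _) (trans (*-congˡ g₀≈0) (zeroʳ _))
  shift f g g₀≈0 (suc zero) =
    +-congˡ (trans (+-identityʳ _) (trans (*-congˡ g₀≈0) (zeroʳ _)))
  shift f g g₀≈0 (suc (suc n)) =
    +-congˡ (shift (λ j → f (suc j)) g g₀≈0 (suc n))

  divide-t∙ : ∀ f g → g 0 # 0# ⊎ (g 0 ≈ 0# × g 1 # 0#) → ∃[ G ] (G ⊛ g ≋ t∙ f)
  divide-t∙ f g (inj₁ g₀#0)          = divide (t∙ f) g g₀#0 , divide-⊛ (t∙ f) g g₀#0
  divide-t∙ f g (inj₂ (g₀≈0 , g₁#0)) = G , λ n → trans (shift G g g₀≈0 n) (eq n)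
    where
    g/t : Series
    g/t n = g (suc n)
    G : Series
    G = divide f g/t g₁#0
    eq : t∙ (G ⊛ g/t) ≋ t∙ f
    eq zero    = refl
    eq (suc n) = divide-⊛ f g/t g₁#0 n

  0!⁻¹≈1 : 0 !⁻¹ ≈ 1#
  0!⁻¹≈1 = begin
    0 !⁻¹             ≈⟨ *-identityˡ _ ⟨
    1# * 0 !⁻¹        ≈⟨ *-congʳ (+-identityʳ 1#) ⟨
    ⟦ 1 ⟧ * 0 !⁻¹     ≈⟨ x*x⁻¹≈1 (char0 1) ⟩
    1#                 ∎
    where open ≈-Reasoning setoid

  n!⁻¹#0 : ∀ n → n !⁻¹ # 0#
  n!⁻¹#0 n = unit⇒#0 (trans (*-comm _ _) (x*x⁻¹≈1 (char0 (n !) {{n ℕ.!≢0}})))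

  #-factor : ∀ {x y z w u} → x - y ≈ (z - w) * u → x # y → z # w
  #-factor {x} {y} {z} {w} {u} eq x#y = invertibleʳ⇒# (u * i , (begin
    (z - w) * (u * i)   ≈⟨ *-assoc _ _ _ ⟨
    (z - w) * u * i     ≈⟨ *-congʳ eq ⟨
    (x - y) * i         ≈⟨ proj₂ (proj₂ (#⇒invertible x#y)) ⟩
    1#                  ∎))
    where
    open ≈-Reasoning setoid
    i = proj₁ (#⇒invertible x#y)


  geometric : Carrier → ℕ → Carrier
  geometric x zero    = 0#
  geometric x (suc n) = 1# + x * geometric x n

  geometric-telescopes : ∀ x n → x * geometric x n + 1# ≈ geometric x n + x ^ n
  geometric-telescopes x zero    = +-congʳ (zeroʳ x)
  geometric-telescopes x (suc n) = begin
    x * (1# + x * g) + 1#         ≈⟨ +-congʳ (*-congˡ (+-comm _ _)) ⟩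
    x * (x * g + 1#) + 1#         ≈⟨ +-congʳ (*-congˡ (geometric-telescopes x n)) ⟩
    x * (g + x ^ n) + 1#          ≈⟨ +-congʳ (distribˡ _ _ _) ⟩
    x * g + x * x ^ n + 1#        ≈⟨ +-comm _ _ ⟩
    1# + (x * g + x * x ^ n)      ≈⟨ +-assoc _ _ _ ⟨
    1# + x * g + x * x ^ n        ∎
    where
    open ≈-Reasoning setoid
    g = geometric x n

  geometric#n⇒#1 : ∀ x n → geometric x n # ⟦ n ⟧ → x # 1#
  geometric#n⇒#1 x zero    0#0 = ⊥-elim (#-irrefl refl 0#0)
  geometric#n⇒#1 x (suc n) g#n with #-cotrans (#-factor cancel g#n) g
    where
    open ≈-Reasoning setoid
    g = geometric x n
    cancel : (1# + x * g) - (1# + ⟦ n ⟧) ≈ (x * g - ⟦ n ⟧) * 1#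
    cancel = begin
      (1# + x * g) - (1# + ⟦ n ⟧)        ≈⟨ +-cong (+-comm _ _) (-‿anti-homo-+ _ _) ⟩
      (x * g + 1#) + (- ⟦ n ⟧ - 1#)      ≈⟨ +-congˡ (+-comm _ _) ⟩
      (x * g + 1#) + (- 1# - ⟦ n ⟧)      ≈⟨ +-assoc _ _ _ ⟩
      x * g + (1# + (- 1# - ⟦ n ⟧))      ≈⟨ +-congˡ (+-assoc _ _ _) ⟨
      x * g + ((1# - 1#) - ⟦ n ⟧)        ≈⟨ +-congˡ (+-congʳ (-‿inverseʳ 1#)) ⟩
      x * g + (0# - ⟦ n ⟧)               ≈⟨ +-congˡ (+-identityˡ _) ⟩
      x * g - ⟦ n ⟧                      ≈⟨ *-identityʳ _ ⟨
      (x * g - ⟦ n ⟧) * 1#               ∎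
  ... | inj₁ xg#g = #-factor (sym (trans ([y-z]x≈yx-zx _ _ _)
                                         (+-congˡ (-‿cong (*-identityˡ _))))) xg#g
  ... | inj₂ g#n′ = geometric#n⇒#1 x n g#n′

  rootOfUnity-≈1⊎#1 : ∀ N → .{{NonZero N}} → ∀ x → x ^ N ≈ 1# → x ≈ 1# ⊎ x # 1#
  rootOfUnity-≈1⊎#1 N x xᴺ≈1 with #-cotrans (char0 N) (geometric x N)
  ... | inj₁ N#g = inj₂ (geometric#n⇒#1 x N (#-sym N#g))
  ... | inj₂ g#0 = inj₁ (begin
    x                ≈⟨ *-identityʳ x ⟨
    x * 1#           ≈⟨ *-congˡ (x*x⁻¹≈1 g#0) ⟨
    x * (g * g⁻¹)    ≈⟨ *-assoc _ _ _ ⟨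
    x * g * g⁻¹      ≈⟨ *-congʳ xg≈g ⟩
    g * g⁻¹          ≈⟨ x*x⁻¹≈1 g#0 ⟩
    1#               ∎)
    where
    open ≈-Reasoning setoid
    g   = geometric x N
    g⁻¹ = g ⁻¹[ g#0 ]
    xg≈g : x * g ≈ g
    xg≈g = +-cancelʳ 1# _ _ (trans (geometric-telescopes x N) (+-congˡ xᴺ≈1))

-- χ is extended to all of ℤ by 0 at the integers not coprime to N.
record DirichletCharacter (K : HeytingField c ℓ₁ ℓ₂) (N : ℕ) : Set (c ⊔ ℓ₁ ⊔ ℓ₂) where
  open FieldNotation K
  field
    χ          : ℤ → Carrier
    periodic   : ∀ a → χ (a ℤ.+ + N) ≈ χ a
    χ-1        : χ (+ 1) ≈ 1#
    χ-*        : ∀ a b → χ (a ℤ.* b) ≈ χ a * χ b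
    χ-coprime  : ∀ a → Coprime a (+ N) → χ a # 0#
    χ-¬coprime : ∀ a → ¬ Coprime a (+ N) → χ a ≈ 0#

  IsInducedModulus : ℕ → Set ℓ₁
  IsInducedModulus f =
    f ℕ.∣ N × (∀ a → Coprime a (+ N) → (+ f) ∣ (a ℤ.- + 1) → χ a ≈ 1#)

  HasConductor : ℕ → Set ℓ₁
  HasConductor f = IsInducedModulus f × (∀ g → IsInducedModulus g → f ℕ.≤ g)

module TwistedBernoulli {p : ℕ} (p-prime : Prime p)
  (K : HeytingField c ℓ₁ ℓ₂) (char0 : CharacteristicZero K) where

  open PowerSeries K char0 public

  record Tₚ : Set (c ⊔ ℓ₁) where
    field
      value        : Carrier
      exponent     : ℕ
      exponent≥1   : 1 ℕ.≤ exponent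
      value^pⁿ≈1   : value ^ (p ℕ.^ exponent) ≈ 1#

  open Tₚ using (value) public

  ^-rootOfUnity : ∀ x w N → x ^ N ≈ 1# → (x ^ w) ^ N ≈ 1#
  ^-rootOfUnity x w N xᴺ≈1 = begin
    (x ^ w) ^ N        ≈⟨ ^-assocʳ x w N ⟩
    x ^ (w ℕ.* N)      ≈⟨ ^-congʳ x (ℕ.*-comm w N) ⟩
    x ^ (N ℕ.* w)      ≈⟨ ^-assocʳ x N w ⟨
    (x ^ N) ^ w        ≈⟨ ^-congˡ w xᴺ≈1 ⟩
    1# ^ w             ≈⟨ 1^ w ⟩
    1#                 ∎
    where
    open ≈-Reasoning setoid
    open Exp semiring using (^-assocʳ; ^-congʳ; ^-congˡ)
    1^ : ∀ w → 1# ^ w ≈ 1#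
    1^ zero    = refl
    1^ (suc w) = trans (*-identityˡ _) (1^ w)

  infixr 8 _^ᵀ_
  _^ᵀ_ : Tₚ → ℕ → Tₚ
  ξ ^ᵀ w = record
    { value      = value ξ ^ w
    ; exponent   = Tₚ.exponent ξ
    ; exponent≥1 = Tₚ.exponent≥1 ξ
    ; value^pⁿ≈1 = ^-rootOfUnity (value ξ) w (p ℕ.^ Tₚ.exponent ξ) (Tₚ.value^pⁿ≈1 ξ)
    }

  module _ {d : ℕ} .{{_ : NonZero d}} (X : DirichletCharacter K d) (ξ : Tₚ) where

    open DirichletCharacter X using (χ)

    -- ∑_{a < d} χ(a) ξᵃ e^{at}
    characterSum : Series
    characterSum n =
      ∑[ a < d ] (χ (+ toℕ a) * value ξ ^ toℕ a * exp[ ⟦ toℕ a ⟧ ] n)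

    -- ξᵈ e^{dt} - 1
    denominator : Series
    denominator n = value ξ ^ d * exp[ ⟦ d ⟧ ] n - 1ˢ n

    ξᵈ-≈1⊎#1 : value ξ ^ d ≈ 1# ⊎ value ξ ^ d # 1#
    ξᵈ-≈1⊎#1 = rootOfUnity-≈1⊎#1 (p ℕ.^ Tₚ.exponent ξ) {{pⁿ≢0}} (value ξ ^ d)
      (^-rootOfUnity (value ξ) d (p ℕ.^ Tₚ.exponent ξ) (Tₚ.value^pⁿ≈1 ξ))
      where
      pⁿ≢0 : NonZero (p ℕ.^ Tₚ.exponent ξ)
      pⁿ≢0 = ℕ.m^n≢0 p (Tₚ.exponent ξ) {{prime⇒nonZero p-prime}}

    denominator₀≈ξᵈ-1 : denominator 0 ≈ value ξ ^ d - 1#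
    denominator₀≈ξᵈ-1 =
      +-congʳ (trans (*-congˡ (trans (*-identityˡ _) 0!⁻¹≈1)) (*-identityʳ _))

    -- The series t ∑ χ(a) ξᵃ e^{at} / (ξᵈ e^{dt} - 1).  If ξᵈ = 1 the denominator
    -- is t times a series with invertible constant term d, and the factor t cancels.
    -- The quotient is unique: the coefficient ξᵈ d of t in the denominator is a unit.
    generatingQuotient : ∃[ G ] (G ⊛ denominator ≋ t∙ characterSum)
    generatingQuotient =
      divide-t∙ characterSum denominator ([ whenξᵈ≈1 , whenξᵈ#1 ]′ ξᵈ-≈1⊎#1)
      where
      whenξᵈ#1 : value ξ ^ d # 1# →
        denominator 0 # 0# ⊎ (denominator 0 ≈ 0# × denominator 1 # 0#)
      whenξᵈ#1 ξᵈ#1 = inj₁ (#-factor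
        (sym (trans (*-identityʳ _) (trans (x-0≈x _) denominator₀≈ξᵈ-1))) ξᵈ#1)
      whenξᵈ≈1 : value ξ ^ d ≈ 1# →
        denominator 0 # 0# ⊎ (denominator 0 ≈ 0# × denominator 1 # 0#)
      whenξᵈ≈1 ξᵈ≈1 = inj₂
        ( trans denominator₀≈ξᵈ-1 (trans (+-congʳ ξᵈ≈1) (-‿inverseʳ 1#))
        , #-congʳ (sym (x-0≈x _))
            (x#0y#0→xy#0 (#-congʳ (sym ξᵈ≈1) 1#0)
              (x#0y#0→xy#0 (#-congʳ (sym (*-identityʳ _)) (char0 d)) (n!⁻¹#0 1))))

    -- B k n x is B_{n,χ,ξ}^{(k)}(x).
    B : ℕ → ℕ → Carrier → Carrier
    B k n x = ⟦ n ! ⟧ * (proj₁ generatingQuotient ^ˢ k ⊛ exp[ x ]) n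

module Submission where

-- The two sides agree because, up to the factor w₁ w₂, both are n! times the
-- coefficient of tⁿ⁺¹ in one series that is symmetric in w₁ and w₂:
--
--   G₁(w₁t)ᵐ G₂(w₂t)ᵐ e^{w₁w₂xt} e^{w₁w₂yt} (ξ^{w₁w₂d} e^{w₁w₂dt} - 1),
--
-- where Gⱼ is the generating quotient attached to z = ξ^{wⱼ}, that is
-- G (zᵈ e^{dt} - 1) = t ∑_{a<d} χ(a) zᵃ e^{at}.
--
-- Multiplying the left side by w₁ turns its sum over k into a Cauchy product
-- (binomialConvolution), and summing over i gives w₁ times the left side as
-- n! times the coefficient of tⁿ in
--
--   G₁(w₁t)ᵐ e^{w₁w₂xt} T(w₂t) G₂(w₂t)ᵐ⁻¹ e^{w₁w₂yt},
--   T(t) = ∑_{i<w₁d} χ(i) ξ^{w₂i} e^{it}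
--
-- (w₁*side≈).  By the periodicity of χ, the twisted character sums of length wd
-- satisfy the same recursion in w as the series z^{wd} e^{wdt} - 1, so that
-- G (z^{wd} e^{wdt} - 1) = t ∑_{a<wd} χ(a) zᵃ e^{at} for every w
-- (quotient-⊛-multiple); nothing has to be cancelled in the ring of series.
-- Taking z = ξ^{w₂} and w = w₁ and substituting w₂t for t gives
-- w₂ t T(w₂t) = G₂(w₂t) (ξ^{w₁w₂d} e^{w₁w₂dt} - 1).  So a further factor w₂ t
-- completes the power G₂(w₂t)ᵐ and yields the symmetric series (symmetricForm).
-- Finally the factors w₁ and w₂, which are invertible in characteristic zero,
-- are cancelled.

open import Defs
open import Algebra.Apartness.Bundles using (HeytingField)
open import Algebra.Bundles using (CommutativeRing)
import Algebra.Construct.Pointwise as Pointwise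
import Algebra.Properties.CommutativeSemiring.Binomial as Binomial
import Algebra.Properties.CommutativeSemiring.Exp as Exp
import Algebra.Properties.Ring as RingProperties
import Algebra.Properties.Semiring.Mult as Mult
import Algebra.Properties.Semiring.Sum as Sum
import Algebra.Solver.Ring.NaturalCoefficients.Default as Solver
open import Data.Fin.Base using (Fin; toℕ)
open import Data.Fin.Properties using (toℕ≤pred[n])
open import Data.Integer.Base using (ℤ; +_; _⊖_)
import Data.Integer.Base as ℤ
open import Data.Nat.Base using (ℕ; zero; suc; NonZero; _∸_; _!)
import Data.Nat.Base as ℕ
open import Data.Nat.Combinatorics using (_C_; nCk≡n!/k![n-k]!; k![n∸k]!∣n!)
open import Data.Nat.DivMod using (m*[n/m]≡n)
open import Data.Nat.Primality using (Prime; prime⇒nonZero)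
import Data.Nat.Properties as ℕ
open import Data.Product.Base using (∃-syntax; _×_; _,_; proj₁; proj₂)
open import Data.Sum.Base using (_⊎_; [_,_]′)
open import Level using (Level; _⊔_)
open import Relation.Binary.PropositionalEquality.Core as ≡ using (_≡_)
import Relation.Binary.Reasoning.Setoid as ≈-Reasoning

module SeriesAlgebra {c ℓ₁ ℓ₂ : Level}
  (K : HeytingField c ℓ₁ ℓ₂) (char0 : CharacteristicZero K) where

  open PowerSeries K char0
  private module K = CommutativeRing ring-K
  open CommutativeRing ring-K using (commutativeSemiring)
  open RingProperties ring using (x[y-z]≈xy-xz)
  open Exp commutativeSemiring using (^-homo-*; ^-assocʳ; ^-congʳ; ^-congˡ; ^-distrib-*)
  open Mult semiring using (×-homo-+; ×1-homo-*; ×-assoc-*; ×-congʳ)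
  open Sum semiring using (sum-cong-≋; *-distribˡ-sum; ∑-distrib-+; ∑-comm)
  open Solver commutativeSemiring using (solve; _:*_; _:+_; _:=_; con)

  -- The ring of formal power series, with the Cauchy product _⊛_.

  infixl 6 _⊕_
  _⊕_ : Series → Series → Series
  (f ⊕ g) n = f n + g n

  ⊛-cong : ∀ {f f′ g g′} → f ≋ f′ → g ≋ g′ → f ⊛ g ≋ f′ ⊛ g′
  ⊛-cong f≋f′ g≋g′ n =
    sum-cong-≋ {suc n} λ k → *-cong (f≋f′ (toℕ k)) (g≋g′ (n ∸ toℕ k))

  ⊛-distribʳ : ∀ h f g → (f ⊕ g) ⊛ h ≋ (f ⊛ h) ⊕ (g ⊛ h)
  ⊛-distribʳ h f g n =
    trans (sum-cong-≋ {suc n} λ k → distribʳ (h (n ∸ toℕ k)) (f (toℕ k)) (g (toℕ k)))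
          (∑-distrib-+ {suc n} (λ k → f (toℕ k) * h (n ∸ toℕ k)) λ k → g (toℕ k) * h (n ∸ toℕ k))

  scalar-⊛ : ∀ a f g → (λ j → a * f j) ⊛ g ≋ (λ j → a * (f ⊛ g) j)
  scalar-⊛ a f g n =
    trans (sum-cong-≋ {suc n} λ k → *-assoc a (f (toℕ k)) (g (n ∸ toℕ k)))
          (sym (*-distribˡ-sum {suc n} a λ k → f (toℕ k) * g (n ∸ toℕ k)))

  -- The defining sum gives (f ⊛ g) (suc n) = f 0 * g (suc n) + (tail f ⊛ g) n
  -- by computation; this is the mirror image.
  ⊛-sucʳ : ∀ f g n → (f ⊛ g) (suc n) ≈ (f ⊛ (λ j → g (suc j))) n + f (suc n) * g 0
  ⊛-sucʳ f g zero    = solve 2 (λ a b → a :+ (b :+ con 0) := (a :+ con 0) :+ b) refl _ _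
  ⊛-sucʳ f g (suc n) =
    trans (+-congˡ (⊛-sucʳ (λ j → f (suc j)) g n)) (sym (+-assoc _ _ _))

  ⊛-comm : ∀ f g → f ⊛ g ≋ g ⊛ f
  ⊛-comm f g zero    = +-congʳ (*-comm _ _)
  ⊛-comm f g (suc n) = begin
    f 0 * g (suc n) + ((λ j → f (suc j)) ⊛ g) n   ≈⟨ +-cong (*-comm _ _) (⊛-comm (λ j → f (suc j)) g n) ⟩
    g (suc n) * f 0 + (g ⊛ (λ j → f (suc j))) n   ≈⟨ +-comm _ _ ⟩
    (g ⊛ (λ j → f (suc j))) n + g (suc n) * f 0   ≈⟨ ⊛-sucʳ g f n ⟨
    (g ⊛ f) (suc n)                               ∎
    where open ≈-Reasoning setoid

  ⊛-assoc : ∀ f g h → (f ⊛ g) ⊛ h ≋ f ⊛ (g ⊛ h)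
  ⊛-assoc f g h zero    = solve 3
    (λ a b c → (a :* b :+ con 0) :* c :+ con 0 := a :* (b :* c :+ con 0) :+ con 0)
    refl _ _ _
  ⊛-assoc f g h (suc n) = begin
    (f 0 * g 0 + 0#) * h (suc n) + (((λ j → f 0 * g (suc j)) ⊕ (f′ ⊛ g)) ⊛ h) n
      ≈⟨ +-congˡ (⊛-distribʳ h (λ j → f 0 * g (suc j)) (f′ ⊛ g) n) ⟩
    (f 0 * g 0 + 0#) * h (suc n) + (((λ j → f 0 * g (suc j)) ⊛ h) n + ((f′ ⊛ g) ⊛ h) n)
      ≈⟨ +-congˡ (+-cong (scalar-⊛ (f 0) g′ h n) (⊛-assoc f′ g h n)) ⟩
    (f 0 * g 0 + 0#) * h (suc n) + (f 0 * (g′ ⊛ h) n + (f′ ⊛ (g ⊛ h)) n)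
      ≈⟨ solve 5 (λ a b c x y → (a :* b :+ con 0) :* c :+ (a :* x :+ y)
                             := a :* (b :* c :+ x) :+ y) refl _ _ _ _ _ ⟩
    f 0 * (g 0 * h (suc n) + (g′ ⊛ h) n) + (f′ ⊛ (g ⊛ h)) n
      ∎
    where
    open ≈-Reasoning setoid
    f′ g′ : Series
    f′ j = f (suc j)
    g′ j = g (suc j)

  0ˢ-⊛ : ∀ f → (λ _ → 0#) ⊛ f ≋ (λ _ → 0#)
  0ˢ-⊛ f zero    = trans (+-identityʳ _) (zeroˡ _)
  0ˢ-⊛ f (suc n) = trans (+-cong (zeroˡ _) (0ˢ-⊛ f n)) (+-identityˡ _)

  ⊛-identityˡ : ∀ f → 1ˢ ⊛ f ≋ f
  ⊛-identityˡ f zero    = trans (+-identityʳ _) (*-identityˡ _)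
  ⊛-identityˡ f (suc n) = trans (+-cong (*-identityˡ _) (0ˢ-⊛ f n)) (+-identityʳ _)

  seriesRing : CommutativeRing c ℓ₁
  seriesRing = record
    { Carrier = Series
    ; _≈_     = _≋_
    ; _+_     = _⊕_
    ; _*_     = _⊛_
    ; -_      = λ f n → - f n
    ; 0#      = λ _ → 0#
    ; 1#      = 1ˢ
    ; isCommutativeRing = record
      { isRing = record
        { +-isAbelianGroup = Pointwise.isAbelianGroup ℕ K.+-isAbelianGroup
        ; *-cong           = ⊛-cong
        ; *-assoc          = ⊛-assoc
        ; *-identity       = ⊛-identityˡ , λ f n → trans (⊛-comm f 1ˢ n) (⊛-identityˡ f n)
        ; distrib          =
            (λ h f g n → trans (⊛-comm h (f ⊕ g) n)
              (trans (⊛-distribʳ h f g n) (+-cong (⊛-comm f h n) (⊛-comm g h n))))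
          , ⊛-distribʳ
        }
      ; *-comm = ⊛-comm
      }
    }

  module 𝕊 = CommutativeRing seriesRing
  open Solver 𝕊.commutativeSemiring using ()
    renaming (solve to solveˢ; _:*_ to _⊠_; _:+_ to _⊞_; _:=_ to _⊜_)

  -- Exponential series and binomial convolutions.

  ⟦*⟧ : ∀ m n → ⟦ m ℕ.* n ⟧ ≈ ⟦ m ⟧ * ⟦ n ⟧
  ⟦*⟧ = ×1-homo-*

  ⟦⟧-cong : ∀ {m n} → m ≡ n → ⟦ m ⟧ ≈ ⟦ n ⟧
  ⟦⟧-cong ≡.refl = refl

  n!*n!⁻¹≈1 : ∀ n → ⟦ n ! ⟧ * n !⁻¹ ≈ 1#
  n!*n!⁻¹≈1 n = x*x⁻¹≈1 (char0 (n !) {{n ℕ.!≢0}})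

  *-cancelˡ-inverse : ∀ {a a⁻¹ b c} → a * a⁻¹ ≈ 1# → a * b ≈ a * c → b ≈ c
  *-cancelˡ-inverse {a} {a⁻¹} {b} {c} aa⁻¹≈1 ab≈ac = begin
    b               ≈⟨ undo b ⟨
    a⁻¹ * (a * b)   ≈⟨ *-congˡ ab≈ac ⟩
    a⁻¹ * (a * c)   ≈⟨ undo c ⟩
    c               ∎
    where
    open ≈-Reasoning setoid
    undo : ∀ z → a⁻¹ * (a * z) ≈ z
    undo z = trans (solve 3 (λ a u z → u :* (a :* z) := (a :* u) :* z) refl a a⁻¹ z)
                   (trans (*-congʳ aa⁻¹≈1) (*-identityˡ z))

  k!*[n-k]!*nCk≈n! : ∀ n (k : Fin (suc n)) →
    ⟦ toℕ k ! ⟧ * ⟦ (n ∸ toℕ k) ! ⟧ * ⟦ n C toℕ k ⟧ ≈ ⟦ n ! ⟧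
  k!*[n-k]!*nCk≈n! n k = begin
    ⟦ j ! ⟧ * ⟦ (n ∸ j) ! ⟧ * ⟦ n C j ⟧      ≈⟨ *-congʳ (⟦*⟧ (j !) ((n ∸ j) !)) ⟨
    ⟦ j ! ℕ.* (n ∸ j) ! ⟧ * ⟦ n C j ⟧        ≈⟨ ⟦*⟧ (j ! ℕ.* (n ∸ j) !) (n C j) ⟨
    ⟦ j ! ℕ.* (n ∸ j) ! ℕ.* (n C j) ⟧        ≈⟨ ⟦⟧-cong (≡.cong (j ! ℕ.* (n ∸ j) ! ℕ.*_) (nCk≡n!/k![n-k]! j≤n)) ⟩
    ⟦ j ! ℕ.* (n ∸ j) ! ℕ.* _ ⟧              ≈⟨ ⟦⟧-cong (m*[n/m]≡n (k![n∸k]!∣n! j≤n)) ⟩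
    ⟦ n ! ⟧                                  ∎
    where
    open ≈-Reasoning setoid
    j   = toℕ k
    j≤n = toℕ≤pred[n] k
    instance
      _ = j ℕ.!* (n ∸ j) !≢0

  -- The sequences n! fₙ and n! gₙ have n! (f ⊛ g)ₙ as their binomial convolution.
  binomialConvolution : ∀ f g n →
    ∑[ k ≤ n ] (⟦ n C toℕ k ⟧ * (⟦ toℕ k ! ⟧ * f (toℕ k)) * (⟦ (n ∸ toℕ k) ! ⟧ * g (n ∸ toℕ k)))
    ≈ ⟦ n ! ⟧ * (f ⊛ g) n
  binomialConvolution f g n = trans
    (sum-cong-≋ {suc n} λ k → trans
      (solve 5 (λ b p a q c → b :* (p :* a) :* (q :* c) := (p :* q :* b) :* (a :* c)) refl
        ⟦ n C toℕ k ⟧ ⟦ toℕ k ! ⟧ (f (toℕ k)) ⟦ (n ∸ toℕ k) ! ⟧ (g (n ∸ toℕ k)))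
      (*-congʳ (k!*[n-k]!*nCk≈n! n k)))
    (sym (*-distribˡ-sum {suc n} ⟦ n ! ⟧ λ k → f (toℕ k) * g (n ∸ toℕ k)))

  n!*exp≈x^n : ∀ x n → ⟦ n ! ⟧ * exp[ x ] n ≈ x ^ n
  n!*exp≈x^n x n = trans
    (solve 3 (λ a b c → a :* (b :* c) := (a :* c) :* b) refl _ _ _)
    (trans (*-congʳ (n!*n!⁻¹≈1 n)) (*-identityˡ _))

  exp-+ : ∀ x y → exp[ x ] ⊛ exp[ y ] ≋ exp[ x + y ]
  exp-+ x y n = *-cancelˡ-inverse (n!*n!⁻¹≈1 n) (begin
    ⟦ n ! ⟧ * (exp[ x ] ⊛ exp[ y ]) n
      ≈⟨ binomialConvolution exp[ x ] exp[ y ] n ⟨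
    ∑[ k ≤ n ] (⟦ n C toℕ k ⟧ * (⟦ toℕ k ! ⟧ * exp[ x ] (toℕ k)) * (⟦ (n ∸ toℕ k) ! ⟧ * exp[ y ] (n ∸ toℕ k)))
      ≈⟨ sum-cong-≋ {suc n} term ⟩
    ∑[ k ≤ n ] ((n C toℕ k) · (x ^ toℕ k * y ^ (n ∸ toℕ k)))
      ≈⟨ Binomial.theorem commutativeSemiring n x y ⟨
    (x + y) ^ n
      ≈⟨ n!*exp≈x^n (x + y) n ⟨
    ⟦ n ! ⟧ * exp[ x + y ] n
      ∎)
    where
    open ≈-Reasoning setoid
    term : ∀ (k : Fin (suc n)) →
      ⟦ n C toℕ k ⟧ * (⟦ toℕ k ! ⟧ * exp[ x ] (toℕ k)) * (⟦ (n ∸ toℕ k) ! ⟧ * exp[ y ] (n ∸ toℕ k))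
      ≈ (n C toℕ k) · (x ^ toℕ k * y ^ (n ∸ toℕ k))
    term k = begin
      ⟦ n C j ⟧ * (⟦ j ! ⟧ * exp[ x ] j) * (⟦ (n ∸ j) ! ⟧ * exp[ y ] (n ∸ j))
        ≈⟨ *-cong (*-congˡ (n!*exp≈x^n x j)) (n!*exp≈x^n y (n ∸ j)) ⟩
      ⟦ n C j ⟧ * x ^ j * y ^ (n ∸ j)      ≈⟨ *-assoc _ _ _ ⟩
      ⟦ n C j ⟧ * (x ^ j * y ^ (n ∸ j))    ≈⟨ ×-assoc-* (n C j) 1# _ ⟩
      (n C j) · (1# * (x ^ j * y ^ (n ∸ j)))   ≈⟨ ×-congʳ (n C j) (*-identityˡ _) ⟩
      (n C j) · (x ^ j * y ^ (n ∸ j))      ∎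
      where j = toℕ k

  exp-0 : exp[ 0# ] ≋ 1ˢ
  exp-0 zero    = trans (*-identityˡ _) 0!⁻¹≈1
  exp-0 (suc n) = trans (*-congʳ (zeroˡ _)) (zeroˡ _)

  exp-cong : ∀ {x y} → x ≈ y → exp[ x ] ≋ exp[ y ]
  exp-cong x≈y n = *-congʳ (^-congˡ n x≈y)

  -- Substitution of at for t.

  -- f(at)
  rescale : Carrier → Series → Series
  rescale a f n = a ^ n * f n

  rescale-cong : ∀ a {f g} → f ≋ g → rescale a f ≋ rescale a g
  rescale-cong a f≋g n = *-congˡ (f≋g n)

  rescale-1ˢ : ∀ a → rescale a 1ˢ ≋ 1ˢ
  rescale-1ˢ a zero    = *-identityˡ _
  rescale-1ˢ a (suc n) = zeroʳ _

  rescale-⊛ : ∀ a f g → rescale a (f ⊛ g) ≋ rescale a f ⊛ rescale a g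
  rescale-⊛ a f g n = trans
    (*-distribˡ-sum {suc n} (a ^ n) λ k → f (toℕ k) * g (n ∸ toℕ k))
    (sum-cong-≋ {suc n} λ k → trans (*-congʳ (split k))
      (solve 4 (λ p q b c → (p :* q) :* (b :* c) := (p :* b) :* (q :* c)) refl
        (a ^ toℕ k) (a ^ (n ∸ toℕ k)) (f (toℕ k)) (g (n ∸ toℕ k))))
    where
    split : ∀ (k : Fin (suc n)) → a ^ n ≈ a ^ toℕ k * a ^ (n ∸ toℕ k)
    split k = trans (^-congʳ a (≡.sym (ℕ.m+[n∸m]≡n (toℕ≤pred[n] k))))
                    (^-homo-* a (toℕ k) (n ∸ toℕ k))

  rescale-^ˢ : ∀ a f k → rescale a (f ^ˢ k) ≋ rescale a f ^ˢ k
  rescale-^ˢ a f zero    = rescale-1ˢ a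
  rescale-^ˢ a f (suc k) = 𝕊.trans (rescale-⊛ a f (f ^ˢ k)) (𝕊.*-congˡ {rescale a f} (rescale-^ˢ a f k))

  rescale-exp : ∀ a x → rescale a exp[ x ] ≋ exp[ a * x ]
  rescale-exp a x n = trans (sym (*-assoc _ _ _)) (*-congʳ (sym (^-distrib-* a x n)))

  -- f ↦ t f becomes f ↦ at f.
  rescale-t∙ : ∀ a f n → rescale a (t∙ f) n ≈ a * (t∙ rescale a f) n
  rescale-t∙ a f zero    = trans (zeroʳ _) (sym (zeroʳ a))
  rescale-t∙ a f (suc n) = *-assoc _ _ _

  -- Multiplication by t, and finite sums.

  t∙-cong : ∀ {f g} → f ≋ g → t∙ f ≋ t∙ g
  t∙-cong f≋g zero    = refl
  t∙-cong f≋g (suc n) = f≋g n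

  t∙-⊕ : ∀ f g → t∙ (f ⊕ g) ≋ (t∙ f) ⊕ (t∙ g)
  t∙-⊕ f g zero    = sym (+-identityˡ _)
  t∙-⊕ f g (suc n) = refl

  t∙-⊛ : ∀ f g → (t∙ f) ⊛ g ≋ t∙ (f ⊛ g)
  t∙-⊛ f g zero    = trans (+-identityʳ _) (zeroˡ _)
  t∙-⊛ f g (suc n) = trans (+-congʳ (zeroˡ _)) (+-identityˡ _)

  ⊛-∑ : ∀ {N} f (b : Fin N → Carrier) (g : Fin N → Series) →
    f ⊛ (λ n → ∑[ i < N ] (b i * g i n)) ≋ (λ n → ∑[ i < N ] (b i * (f ⊛ g i) n))
  ⊛-∑ {N} f b g n = begin
    ∑[ k ≤ n ] (f (toℕ k) * (∑[ i < N ] (b i * g i (n ∸ toℕ k))))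
      ≈⟨ sum-cong-≋ {suc n} (λ k → trans
           (*-distribˡ-sum {N} (f (toℕ k)) (λ i → b i * g i (n ∸ toℕ k)))
           (sum-cong-≋ {N} λ i → solve 3 (λ x y z → x :* (y :* z) := y :* (x :* z)) refl _ _ _)) ⟩
    ∑[ k ≤ n ] (∑[ i < N ] (b i * (f (toℕ k) * g i (n ∸ toℕ k))))
      ≈⟨ ∑-comm {suc n} {N} (λ k i → b i * (f (toℕ k) * g i (n ∸ toℕ k))) ⟩
    ∑[ i < N ] (∑[ k ≤ n ] (b i * (f (toℕ k) * g i (n ∸ toℕ k))))
      ≈⟨ sum-cong-≋ {N} (λ i → *-distribˡ-sum {suc n} (b i) (λ k → f (toℕ k) * g i (n ∸ toℕ k))) ⟨
    ∑[ i < N ] (b i * (f ⊛ g i) n)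
      ∎
    where open ≈-Reasoning setoid

  ∑-+ : ∀ m n (f : ℕ → Carrier) →
    ∑[ i < m ℕ.+ n ] f (toℕ i) ≈ ∑[ i < m ] f (toℕ i) + ∑[ i < n ] f (m ℕ.+ toℕ i)
  ∑-+ zero    n f = sym (+-identityˡ _)
  ∑-+ (suc m) n f = trans (+-congˡ (∑-+ m n (λ j → f (suc j)))) (sym (+-assoc _ _ _))

  -- Twisted exponentials and twisted character sums.

  -- zᴺ e^{Nt}
  twistedExp : Carrier → ℕ → Series
  twistedExp z N n = z ^ N * exp[ ⟦ N ⟧ ] n

  -- zᴺ e^{Nt} - 1
  twistedExp-1 : Carrier → ℕ → Series
  twistedExp-1 z N n = twistedExp z N n - 1ˢ n

  -- ∑_{a < N} χ(a) zᵃ e^{at}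
  twistedSum : (ℤ → Carrier) → Carrier → ℕ → Series
  twistedSum χ z N n = ∑[ a < N ] (χ (+ toℕ a) * z ^ toℕ a * exp[ ⟦ toℕ a ⟧ ] n)

  twistedExp-⊛-exp : ∀ z M N →
    twistedExp z M ⊛ exp[ ⟦ N ⟧ ] ≋ (λ n → z ^ M * exp[ ⟦ M ℕ.+ N ⟧ ] n)
  twistedExp-⊛-exp z M N n = trans (scalar-⊛ (z ^ M) exp[ ⟦ M ⟧ ] exp[ ⟦ N ⟧ ] n)
    (*-congˡ (trans (exp-+ ⟦ M ⟧ ⟦ N ⟧ n) (exp-cong (sym (×-homo-+ 1# M N)) n)))

  twistedExp-+ : ∀ z M N → twistedExp z M ⊛ twistedExp z N ≋ twistedExp z (M ℕ.+ N)
  twistedExp-+ z M N n = begin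
    (u M ⊛ u N) n                              ≈⟨ ⊛-comm (u M) (u N) n ⟩
    (u N ⊛ u M) n                              ≈⟨ scalar-⊛ (z ^ N) exp[ ⟦ N ⟧ ] (u M) n ⟩
    z ^ N * (exp[ ⟦ N ⟧ ] ⊛ u M) n             ≈⟨ *-congˡ (⊛-comm exp[ ⟦ N ⟧ ] (u M) n) ⟩
    z ^ N * (u M ⊛ exp[ ⟦ N ⟧ ]) n             ≈⟨ *-congˡ (twistedExp-⊛-exp z M N n) ⟩
    z ^ N * (z ^ M * exp[ ⟦ M ℕ.+ N ⟧ ] n)     ≈⟨ solve 3 (λ a b e → a :* (b :* e) := b :* a :* e) refl _ _ _ ⟩
    z ^ M * z ^ N * exp[ ⟦ M ℕ.+ N ⟧ ] n       ≈⟨ *-congʳ (^-homo-* z M N) ⟨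
    u (M ℕ.+ N) n                              ∎
    where
    open ≈-Reasoning setoid
    u = twistedExp z

  twistedExp-1-0 : ∀ z → twistedExp-1 z 0 ≋ 𝕊.0#
  twistedExp-1-0 z n = trans (+-congʳ (trans (*-identityˡ _) (exp-0 n))) (-‿inverseʳ _)

  twistedExp-1-+ : ∀ z M N →
    twistedExp-1 z (M ℕ.+ N) ≋ twistedExp-1 z M ⊕ (twistedExp z M ⊛ twistedExp-1 z N)
  twistedExp-1-+ z M N = 𝕊.sym (begin
    (u M 𝕊.- 1ˢ) ⊕ (u M ⊛ (u N 𝕊.- 1ˢ))
      ≈⟨ 𝕊.+-congˡ (ˢx[y-z]≈xy-xz (u M) (u N) 1ˢ) ⟩
    (u M 𝕊.- 1ˢ) ⊕ ((u M ⊛ u N) 𝕊.- (u M ⊛ 1ˢ))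
      ≈⟨ 𝕊.+-congˡ (𝕊.+-cong (twistedExp-+ z M N) (𝕊.-‿cong (𝕊.*-identityʳ (u M)))) ⟩
    (u M 𝕊.- 1ˢ) ⊕ (u (M ℕ.+ N) 𝕊.- u M)
      ≈⟨ solveˢ 4 (λ a b c d → (a ⊞ b) ⊞ (c ⊞ d) ⊜ (a ⊞ d) ⊞ (c ⊞ b)) 𝕊.refl (u M) (𝕊.- 1ˢ) (u (M ℕ.+ N)) (𝕊.- u M) ⟩
    (u M 𝕊.- u M) ⊕ (u (M ℕ.+ N) 𝕊.- 1ˢ)
      ≈⟨ 𝕊.+-congʳ (𝕊.-‿inverseʳ (u M)) ⟩
    𝕊.0# ⊕ (u (M ℕ.+ N) 𝕊.- 1ˢ)
      ≈⟨ 𝕊.+-identityˡ _ ⟩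
    u (M ℕ.+ N) 𝕊.- 1ˢ
      ∎)
    where
    open ≈-Reasoning 𝕊.setoid
    open RingProperties 𝕊.ring using () renaming (x[y-z]≈xy-xz to ˢx[y-z]≈xy-xz)
    u = twistedExp z

  -- Only the periodicity of χ matters, not its multiplicativity.
  module _ (χ : ℤ → Carrier) (d : ℕ) (periodic : ∀ a → χ (a ℤ.+ + d) ≈ χ a) where

    twistedSum-+ : ∀ z N →
      twistedSum χ z (d ℕ.+ N) ≋ twistedSum χ z d ⊕ (twistedExp z d ⊛ twistedSum χ z N)
    twistedSum-+ z N n = trans
      (∑-+ d N (λ a → χ (+ a) * z ^ a * exp[ ⟦ a ⟧ ] n))
      (+-congˡ (sym (trans
        (⊛-∑ {N} (twistedExp z d) (λ a → χ (+ toℕ a) * z ^ toℕ a) (λ a → exp[ ⟦ toℕ a ⟧ ]) n)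
        (sum-cong-≋ {N} (λ a → term (toℕ a))))))
      where
      open ≈-Reasoning setoid
      term : ∀ a → χ (+ a) * z ^ a * (twistedExp z d ⊛ exp[ ⟦ a ⟧ ]) n
        ≈ χ (+ (d ℕ.+ a)) * z ^ (d ℕ.+ a) * exp[ ⟦ d ℕ.+ a ⟧ ] n
      term a = begin
        χ (+ a) * z ^ a * (twistedExp z d ⊛ exp[ ⟦ a ⟧ ]) n
          ≈⟨ *-congˡ (twistedExp-⊛-exp z d a n) ⟩
        χ (+ a) * z ^ a * (z ^ d * exp[ ⟦ d ℕ.+ a ⟧ ] n)
          ≈⟨ solve 4 (λ x p q e → x :* p :* (q :* e) := x :* (q :* p) :* e) refl _ _ _ _ ⟩
        χ (+ a) * (z ^ d * z ^ a) * exp[ ⟦ d ℕ.+ a ⟧ ] n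
          ≈⟨ *-congʳ (*-cong (sym χ[d+a]) (sym (^-homo-* z d a))) ⟩
        χ (+ (d ℕ.+ a)) * z ^ (d ℕ.+ a) * exp[ ⟦ d ℕ.+ a ⟧ ] n
          ∎
        where
        χ[d+a] : χ (+ (d ℕ.+ a)) ≈ χ (+ a)
        χ[d+a] = trans (reflexive (≡.cong (λ j → χ (+ j)) (ℕ.+-comm d a))) (periodic (+ a))

    -- From z^{(1+w)d} e^{(1+w)dt} - 1 = (zᵈ e^{dt} - 1) + zᵈ e^{dt} (z^{wd} e^{wdt} - 1)
    -- and the same recursion for the character sums.
    quotient-⊛-multiple : ∀ G z → G ⊛ twistedExp-1 z d ≋ t∙ twistedSum χ z d →
      ∀ w → G ⊛ twistedExp-1 z (w ℕ.* d) ≋ t∙ twistedSum χ z (w ℕ.* d)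
    quotient-⊛-multiple G z eq zero = 𝕊.trans
      (𝕊.trans (𝕊.*-congˡ {G} (twistedExp-1-0 z)) (𝕊.zeroʳ G)) t∙0
      where
      t∙0 : 𝕊.0# ≋ t∙ twistedSum χ z 0
      t∙0 zero    = refl
      t∙0 (suc n) = refl
    quotient-⊛-multiple G z eq (suc w) = begin
      G ⊛ D (d ℕ.+ N)                     ≈⟨ 𝕊.*-congˡ {G} (twistedExp-1-+ z d N) ⟩
      G ⊛ (D d ⊕ (u ⊛ D N))               ≈⟨ solveˢ 4 (λ g a u b → g ⊠ (a ⊞ u ⊠ b) ⊜ g ⊠ a ⊞ (g ⊠ b) ⊠ u) 𝕊.refl G (D d) u (D N) ⟩
      (G ⊛ D d) ⊕ ((G ⊛ D N) ⊛ u)         ≈⟨ 𝕊.+-cong eq (𝕊.*-congʳ {u} (quotient-⊛-multiple G z eq w)) ⟩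
      (t∙ S d) ⊕ ((t∙ S N) ⊛ u)           ≈⟨ 𝕊.+-congˡ {t∙ S d} (t∙-⊛ (S N) u) ⟩
      (t∙ S d) ⊕ (t∙ (S N ⊛ u))           ≈⟨ t∙-⊕ (S d) (S N ⊛ u) ⟨
      t∙ (S d ⊕ (S N ⊛ u))                ≈⟨ t∙-cong (𝕊.+-congˡ {S d} (⊛-comm (S N) u)) ⟩
      t∙ (S d ⊕ (u ⊛ S N))                ≈⟨ t∙-cong (twistedSum-+ z N) ⟨
      t∙ S (d ℕ.+ N)                      ∎
      where
      open ≈-Reasoning 𝕊.setoid
      N = w ℕ.* d
      D = twistedExp-1 z
      S = twistedSum χ z
      u = twistedExp z d

  rescale-twistedSum : ∀ χ z w N → rescale ⟦ w ⟧ (twistedSum χ (z ^ w) N)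
    ≋ (λ n → ∑[ i < N ] (χ (+ toℕ i) * z ^ (w ℕ.* toℕ i) * exp[ ⟦ w ⟧ * ⟦ toℕ i ⟧ ] n))
  rescale-twistedSum χ z w N n = trans
    (*-distribˡ-sum {N} (⟦ w ⟧ ^ n)
      λ i → χ (+ toℕ i) * (z ^ w) ^ toℕ i * exp[ ⟦ toℕ i ⟧ ] n)
    (sum-cong-≋ {N} λ i → term (toℕ i))
    where
    term : ∀ i → ⟦ w ⟧ ^ n * (χ (+ i) * (z ^ w) ^ i * exp[ ⟦ i ⟧ ] n)
      ≈ χ (+ i) * z ^ (w ℕ.* i) * exp[ ⟦ w ⟧ * ⟦ i ⟧ ] n
    term i = trans
      (solve 4 (λ a x p e → a :* (x :* p :* e) := x :* p :* (a :* e)) refl _ _ _ _)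
      (*-cong (*-congˡ (^-assocʳ z w i)) (rescale-exp ⟦ w ⟧ ⟦ i ⟧ n))

  rescale-twistedExp-1 : ∀ z w N →
    rescale ⟦ w ⟧ (twistedExp-1 (z ^ w) N) ≋ twistedExp-1 z (w ℕ.* N)
  rescale-twistedExp-1 z w N n = begin
    ⟦ w ⟧ ^ n * ((z ^ w) ^ N * exp[ ⟦ N ⟧ ] n - 1ˢ n)
      ≈⟨ x[y-z]≈xy-xz _ _ _ ⟩
    ⟦ w ⟧ ^ n * ((z ^ w) ^ N * exp[ ⟦ N ⟧ ] n) - ⟦ w ⟧ ^ n * 1ˢ n
      ≈⟨ +-cong (solve 3 (λ a p e → a :* (p :* e) := p :* (a :* e)) refl _ _ _)
                (-‿cong (rescale-1ˢ ⟦ w ⟧ n)) ⟩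
    (z ^ w) ^ N * (⟦ w ⟧ ^ n * exp[ ⟦ N ⟧ ] n) - 1ˢ n
      ≈⟨ +-congʳ (*-cong (^-assocʳ z w N)
           (trans (rescale-exp ⟦ w ⟧ ⟦ N ⟧ n) (exp-cong (sym (⟦*⟧ w N)) n))) ⟩
    z ^ (w ℕ.* N) * exp[ ⟦ w ℕ.* N ⟧ ] n - 1ˢ n
      ∎
    where open ≈-Reasoning setoid

  w*w^ᶻ[k-1]≈w^k : ∀ w .{{_ : NonZero w}} k → ⟦ w ⟧ * w ^ᶻ (k ⊖ 1) ≈ ⟦ w ⟧ ^ k
  w*w^ᶻ[k-1]≈w^k w zero    = trans (*-congˡ (*-identityʳ _)) (x*x⁻¹≈1 (char0 w))
  w*w^ᶻ[k-1]≈w^k w (suc k) = refl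

  -- β k n x = n! [tⁿ] G(t)ᵏ e^{xt} for all k, n and x.
  GeneratedBy : Series → (ℕ → ℕ → Carrier → Carrier) → Set (c ⊔ ℓ₁)
  GeneratedBy G β = ∀ k n x → β k n x ≈ ⟦ n ! ⟧ * (G ^ˢ k ⊛ exp[ x ]) n

  -- One side of the identity, as a coefficient of a series.

  -- β₁ and β₂ stand for the Bernoulli polynomials attached to z^{w₁} and z^{w₂},
  -- and z for ξ.
  module OneSide (χ : ℤ → Carrier) (β₁ β₂ : ℕ → ℕ → Carrier → Carrier)
    (z : Carrier) (w₁ w₂ : ℕ) .{{_ : NonZero w₁}} (x y : Carrier) where

    private
      a₁ = ⟦ w₁ ⟧
      a₂ = ⟦ w₂ ⟧

    -- The inner sum, over i < N, for Bernoulli polynomials of order m and degree k.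
    innerSum : ℕ → ℕ → ℕ → Carrier
    innerSum m N k = ∑[ i < N ] (χ (+ toℕ i) * z ^ (w₂ ℕ.* toℕ i)
      * β₁ m k (a₂ * x + a₂ * (1/ w₁) * ⟦ toℕ i ⟧))

    -- The left side of the identity for order m, with the inner sums over i < N;
    -- exchanging the indices 1 and 2 in all parameters gives the right side.
    side : ℕ → ℕ → ℕ → Carrier
    side m N n = ∑[ k ≤ n ] (⟦ n C toℕ k ⟧ * w₁ ^ᶻ (toℕ k ⊖ 1) * a₂ ^ (n ∸ toℕ k)
      * β₂ (m ∸ 1) (n ∸ toℕ k) (a₁ * y) * innerSum m N (toℕ k))

    -- e^{w₁w₂xt} and e^{w₁w₂yt}
    E = exp[ a₁ * a₂ * x ]
    F = exp[ a₁ * a₂ * y ]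

    module _ {G₁ G₂ : Series} (β₁≈ : GeneratedBy G₁ β₁) (β₂≈ : GeneratedBy G₂ β₂) where

      rescale-G₁ : ∀ m i → rescale a₁ (G₁ ^ˢ m ⊛ exp[ a₂ * x + a₂ * (1/ w₁) * ⟦ i ⟧ ])
        ≋ (rescale a₁ (G₁ ^ˢ m) ⊛ E) ⊛ exp[ a₂ * ⟦ i ⟧ ]
      rescale-G₁ m i = begin
        rescale a₁ (G₁ ^ˢ m ⊛ exp[ s ])
          ≈⟨ rescale-⊛ a₁ (G₁ ^ˢ m) exp[ s ] ⟩
        A ⊛ rescale a₁ exp[ s ]
          ≈⟨ 𝕊.*-congˡ {A} (rescale-exp a₁ s) ⟩
        A ⊛ exp[ a₁ * s ]
          ≈⟨ 𝕊.*-congˡ {A} (exp-cong a₁s≈) ⟩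
        A ⊛ exp[ a₁ * a₂ * x + a₂ * ⟦ i ⟧ ]
          ≈⟨ 𝕊.*-congˡ {A} (exp-+ (a₁ * a₂ * x) (a₂ * ⟦ i ⟧)) ⟨
        A ⊛ (E ⊛ exp[ a₂ * ⟦ i ⟧ ])
          ≈⟨ ⊛-assoc A E exp[ a₂ * ⟦ i ⟧ ] ⟨
        (A ⊛ E) ⊛ exp[ a₂ * ⟦ i ⟧ ]
          ∎
        where
        open ≈-Reasoning 𝕊.setoid
        A = rescale a₁ (G₁ ^ˢ m)
        s = a₂ * x + a₂ * (1/ w₁) * ⟦ i ⟧
        a₁s≈ : a₁ * s ≈ a₁ * a₂ * x + a₂ * ⟦ i ⟧
        a₁s≈ = trans
          (solve 5 (λ a b x r i → a :* (b :* x :+ b :* r :* i) := a :* b :* x :+ (a :* r) :* (b :* i))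
            refl a₁ a₂ x (1/ w₁) ⟦ i ⟧)
          (+-congˡ (trans (*-congʳ (x*x⁻¹≈1 (char0 w₁))) (*-identityˡ _)))

      -- G₁(w₁t)ᵐ e^{w₁w₂xt} ∑_{i<N} χ(i) z^{w₂i} e^{w₂it}
      innerSeries : ℕ → ℕ → Series
      innerSeries m N = (rescale a₁ (G₁ ^ˢ m) ⊛ E) ⊛ rescale a₂ (twistedSum χ (z ^ w₂) N)

      innerSum≈ : ∀ m N k → a₁ ^ k * innerSum m N k ≈ ⟦ k ! ⟧ * innerSeries m N k
      innerSum≈ m N k = begin
        a₁ ^ k * innerSum m N k
          ≈⟨ *-distribˡ-sum {N} (a₁ ^ k) (λ i → χz (toℕ i) * β₁ m k (s (toℕ i))) ⟩
        ∑[ i < N ] (a₁ ^ k * (χz (toℕ i) * β₁ m k (s (toℕ i))))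
          ≈⟨ sum-cong-≋ {N} (λ i → trans (*-congˡ (*-congˡ (β₁≈ m k (s (toℕ i))))) (trans
               (solve 4 (λ a c f q → a :* (c :* (f :* q)) := f :* (c :* (a :* q))) refl
                 (a₁ ^ k) (χz (toℕ i)) ⟦ k ! ⟧ (Q (toℕ i) k))
               (*-congˡ (*-congˡ (rescale-G₁ m (toℕ i) k))))) ⟩
        ∑[ i < N ] (⟦ k ! ⟧ * (χz (toℕ i) * ((A ⊛ E) ⊛ e (toℕ i)) k))
          ≈⟨ *-distribˡ-sum {N} ⟦ k ! ⟧ (λ i → χz (toℕ i) * ((A ⊛ E) ⊛ e (toℕ i)) k) ⟨
        ⟦ k ! ⟧ * (∑[ i < N ] (χz (toℕ i) * ((A ⊛ E) ⊛ e (toℕ i)) k))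
          ≈⟨ *-congˡ (⊛-∑ {N} (A ⊛ E) (λ i → χz (toℕ i)) (λ i → e (toℕ i)) k) ⟨
        ⟦ k ! ⟧ * ((A ⊛ E) ⊛ (λ j → ∑[ i < N ] (χz (toℕ i) * e (toℕ i) j))) k
          ≈⟨ *-congˡ (𝕊.*-congˡ {A ⊛ E} (rescale-twistedSum χ z w₂ N) k) ⟨
        ⟦ k ! ⟧ * innerSeries m N k
          ∎
        where
        open ≈-Reasoning setoid
        A = rescale a₁ (G₁ ^ˢ m)
        χz : ℕ → Carrier
        χz i = χ (+ i) * z ^ (w₂ ℕ.* i)
        e Q : ℕ → Series
        e i = exp[ a₂ * ⟦ i ⟧ ]
        s : ℕ → Carrier
        s i = a₂ * x + a₂ * (1/ w₁) * ⟦ i ⟧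
        Q i = G₁ ^ˢ m ⊛ exp[ s i ]

      rescale-G₂ : ∀ m → rescale a₂ (G₂ ^ˢ m ⊛ exp[ a₁ * y ]) ≋ rescale a₂ (G₂ ^ˢ m) ⊛ F
      rescale-G₂ m = 𝕊.trans (rescale-⊛ a₂ (G₂ ^ˢ m) exp[ a₁ * y ])
        (𝕊.*-congˡ {rescale a₂ (G₂ ^ˢ m)} (𝕊.trans (rescale-exp a₂ (a₁ * y))
          (exp-cong (solve 3 (λ a b y → b :* (a :* y) := a :* b :* y) refl a₁ a₂ y))))

      w₁*side≈ : ∀ m N n → a₁ * side (suc m) N n
        ≈ ⟦ n ! ⟧ * (innerSeries (suc m) N ⊛ (rescale a₂ (G₂ ^ˢ m) ⊛ F)) n
      w₁*side≈ m N n = begin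
        a₁ * side (suc m) N n
          ≈⟨ *-distribˡ-sum {suc n} a₁ summand ⟩
        ∑[ k ≤ n ] (a₁ * summand k)
          ≈⟨ sum-cong-≋ {suc n} term ⟩
        ∑[ k ≤ n ] (⟦ n C toℕ k ⟧ * (⟦ toℕ k ! ⟧ * inner (toℕ k)) * (⟦ (n ∸ toℕ k) ! ⟧ * outer (n ∸ toℕ k)))
          ≈⟨ binomialConvolution inner outer n ⟩
        ⟦ n ! ⟧ * (inner ⊛ outer) n
          ∎
        where
        open ≈-Reasoning setoid
        inner outer : Series
        inner = innerSeries (suc m) N
        outer = rescale a₂ (G₂ ^ˢ m) ⊛ F
        b : ℕ → Carrier
        b = G₂ ^ˢ m ⊛ exp[ a₁ * y ]
        summand : Fin (suc n) → Carrier
        summand k = ⟦ n C toℕ k ⟧ * w₁ ^ᶻ (toℕ k ⊖ 1) * a₂ ^ (n ∸ toℕ k)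
          * β₂ m (n ∸ toℕ k) (a₁ * y) * innerSum (suc m) N (toℕ k)
        term : ∀ k → a₁ * summand k
          ≈ ⟦ n C toℕ k ⟧ * (⟦ toℕ k ! ⟧ * inner (toℕ k)) * (⟦ (n ∸ toℕ k) ! ⟧ * outer (n ∸ toℕ k))
        term k′ = begin
          a₁ * (⟦ n C k ⟧ * w₁ ^ᶻ (k ⊖ 1) * a₂ ^ l * β₂ m l (a₁ * y) * innerSum (suc m) N k)
            ≈⟨ *-congˡ (*-congʳ (*-congˡ (β₂≈ m l (a₁ * y)))) ⟩
          a₁ * (⟦ n C k ⟧ * w₁ ^ᶻ (k ⊖ 1) * a₂ ^ l * (⟦ l ! ⟧ * b l) * innerSum (suc m) N k)
            ≈⟨ solve 7 (λ a c p q f b s → a :* (c :* p :* q :* (f :* b) :* s)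
                                       := c :* ((a :* p) :* s) :* (f :* (q :* b))) refl
                 a₁ ⟦ n C k ⟧ (w₁ ^ᶻ (k ⊖ 1)) (a₂ ^ l) ⟦ l ! ⟧ (b l) (innerSum (suc m) N k) ⟩
          ⟦ n C k ⟧ * (a₁ * w₁ ^ᶻ (k ⊖ 1) * innerSum (suc m) N k) * (⟦ l ! ⟧ * rescale a₂ b l)
            ≈⟨ *-cong
                 (*-congˡ (trans (*-congʳ (w*w^ᶻ[k-1]≈w^k w₁ k)) (innerSum≈ (suc m) N k)))
                 (*-congˡ (rescale-G₂ m l)) ⟩
          ⟦ n C k ⟧ * (⟦ k ! ⟧ * inner k) * (⟦ l ! ⟧ * outer l)
            ∎
          where
          k = toℕ k′
          l = n ∸ k

      -- Apart from the last factor, which depends only on w₂ N, the series is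
      -- symmetric in the indices 1 and 2; for N = w₁ d so is that factor.
      symmetricForm : ∀ m N n →
        G₂ ⊛ twistedExp-1 (z ^ w₂) N ≋ t∙ twistedSum χ (z ^ w₂) N →
        a₂ * (a₁ * side (suc m) N n) ≈ ⟦ n ! ⟧ *
          (((rescale a₁ (G₁ ^ˢ suc m) ⊛ rescale a₂ (G₂ ^ˢ suc m)) ⊛ (E ⊛ F))
            ⊛ twistedExp-1 z (w₂ ℕ.* N)) (suc n)
      symmetricForm m N n eq = begin
        a₂ * (a₁ * side (suc m) N n)                       ≈⟨ *-congˡ (w₁*side≈ m N n) ⟩
        a₂ * (⟦ n ! ⟧ * (((A ⊛ E) ⊛ T) ⊛ (B ⊛ F)) n)       ≈⟨ solve 3 (λ a f p → a :* (f :* p) := f :* (a :* p)) refl _ _ _ ⟩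
        ⟦ n ! ⟧ * (a₂ * (((A ⊛ E) ⊛ T) ⊛ (B ⊛ F)) n)       ≈⟨ *-congˡ (*-congˡ (toFront n)) ⟩
          -- The coefficient of tⁿ is read as that of tⁿ⁺¹ after multiplication by t.
        ⟦ n ! ⟧ * (a₂ * (t∙ (T ⊛ R)) (suc n))              ≈⟨ *-congˡ (*-congˡ (t∙-⊛ T R (suc n))) ⟨
        ⟦ n ! ⟧ * (a₂ * ((t∙ T) ⊛ R) (suc n))              ≈⟨ *-congˡ (scalar-⊛ a₂ (t∙ T) R (suc n)) ⟨
        ⟦ n ! ⟧ * ((λ j → a₂ * (t∙ T) j) ⊛ R) (suc n)      ≈⟨ *-congˡ (𝕊.*-congʳ {R} t∙T≋ (suc n)) ⟩
        ⟦ n ! ⟧ * ((g ⊛ U) ⊛ R) (suc n)                    ≈⟨ *-congˡ (regroup (suc n)) ⟩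
        ⟦ n ! ⟧ * (((A ⊛ (g ⊛ B)) ⊛ (E ⊛ F)) ⊛ U) (suc n)  ≈⟨ *-congˡ (𝕊.*-congʳ {U} (𝕊.*-congʳ {E ⊛ F} (𝕊.*-congˡ {A} (rescale-⊛ a₂ G₂ (G₂ ^ˢ m)))) (suc n)) ⟨
        ⟦ n ! ⟧ * (((A ⊛ rescale a₂ (G₂ ^ˢ suc m)) ⊛ (E ⊛ F)) ⊛ U) (suc n) ∎
        where
        open ≈-Reasoning setoid
        A = rescale a₁ (G₁ ^ˢ suc m)
        B = rescale a₂ (G₂ ^ˢ m)
        T = rescale a₂ (twistedSum χ (z ^ w₂) N)
        U = twistedExp-1 z (w₂ ℕ.* N)
        g = rescale a₂ G₂
        R = (A ⊛ E) ⊛ (B ⊛ F)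
        toFront : ((A ⊛ E) ⊛ T) ⊛ (B ⊛ F) ≋ T ⊛ R
        toFront = solveˢ 3 (λ p t q → (p ⊠ t) ⊠ q ⊜ t ⊠ (p ⊠ q)) 𝕊.refl (A ⊛ E) T (B ⊛ F)
        -- w₂ t T(w₂t) is t T(t) with w₂t substituted for t.
        t∙T≋ : (λ j → a₂ * (t∙ T) j) ≋ g ⊛ U
        t∙T≋ = 𝕊.trans (𝕊.sym (rescale-t∙ a₂ (twistedSum χ (z ^ w₂) N)))
          (𝕊.trans (rescale-cong a₂ (𝕊.sym eq))
            (𝕊.trans (rescale-⊛ a₂ G₂ (twistedExp-1 (z ^ w₂) N))
              (𝕊.*-congˡ {g} (rescale-twistedExp-1 z w₂ N))))
        regroup : (g ⊛ U) ⊛ R ≋ ((A ⊛ (g ⊛ B)) ⊛ (E ⊛ F)) ⊛ U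
        regroup = solveˢ 6 (λ g u a e b f → (g ⊠ u) ⊠ ((a ⊠ e) ⊠ (b ⊠ f))
                                          ⊜ ((a ⊠ (g ⊠ b)) ⊠ (e ⊠ f)) ⊠ u) 𝕊.refl g U A E B F

  -- The symmetry.

  side-symmetric : (χ : ℤ → Carrier) (d : ℕ) (periodic : ∀ a → χ (a ℤ.+ + d) ≈ χ a)
    (z : Carrier) (w₁ w₂ : ℕ) .{{_ : NonZero w₁}} .{{_ : NonZero w₂}}
    (m n : ℕ) (x y : Carrier) →
    ∀ G₁ G₂ {β₁ β₂} → GeneratedBy G₁ β₁ → GeneratedBy G₂ β₂ →
    G₁ ⊛ twistedExp-1 (z ^ w₁) d ≋ t∙ twistedSum χ (z ^ w₁) d →
    G₂ ⊛ twistedExp-1 (z ^ w₂) d ≋ t∙ twistedSum χ (z ^ w₂) d →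
    OneSide.side χ β₁ β₂ z w₁ w₂ x y (suc m) (w₁ ℕ.* d) n
    ≈ OneSide.side χ β₂ β₁ z w₂ w₁ x y (suc m) (w₂ ℕ.* d) n
  side-symmetric χ d periodic z w₁ w₂ m n x y G₁ G₂ {β₁} {β₂} β₁≈ β₂≈ eq₁ eq₂ =
    *-cancelˡ-inverse (x*x⁻¹≈1 (char0 w₁)) (*-cancelˡ-inverse (x*x⁻¹≈1 (char0 w₂)) (begin
      a₂ * (a₁ * L.side (suc m) (w₁ ℕ.* d) n)
        ≈⟨ L.symmetricForm β₁≈ β₂≈ m (w₁ ℕ.* d) n (quotient-⊛-multiple χ d periodic G₂ (z ^ w₂) eq₂ w₁) ⟩
      ⟦ n ! ⟧ * (((P ⊛ Q) ⊛ (L.E ⊛ L.F)) ⊛ twistedExp-1 z (w₂ ℕ.* (w₁ ℕ.* d))) (suc n)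
        ≈⟨ *-congˡ (⊛-cong (⊛-cong (⊛-comm P Q) (⊛-cong (E≋ x) (E≋ y))) D≋ (suc n)) ⟩
      ⟦ n ! ⟧ * (((Q ⊛ P) ⊛ (R.E ⊛ R.F)) ⊛ twistedExp-1 z (w₁ ℕ.* (w₂ ℕ.* d))) (suc n)
        ≈⟨ R.symmetricForm β₂≈ β₁≈ m (w₂ ℕ.* d) n (quotient-⊛-multiple χ d periodic G₁ (z ^ w₁) eq₁ w₂) ⟨
      a₁ * (a₂ * R.side (suc m) (w₂ ℕ.* d) n)
        ≈⟨ solve 3 (λ a b s → a :* (b :* s) := b :* (a :* s)) refl a₁ a₂ _ ⟩
      a₂ * (a₁ * R.side (suc m) (w₂ ℕ.* d) n)
        ∎))
    where
    open ≈-Reasoning setoid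
    module L = OneSide χ β₁ β₂ z w₁ w₂ x y
    module R = OneSide χ β₂ β₁ z w₂ w₁ x y
    a₁ = ⟦ w₁ ⟧
    a₂ = ⟦ w₂ ⟧
    P = rescale a₁ (G₁ ^ˢ suc m)
    Q = rescale a₂ (G₂ ^ˢ suc m)
    E≋ : ∀ s → exp[ a₁ * a₂ * s ] ≋ exp[ a₂ * a₁ * s ]
    E≋ s = exp-cong (*-congʳ (*-comm a₁ a₂))
    D≋ : twistedExp-1 z (w₂ ℕ.* (w₁ ℕ.* d)) ≋ twistedExp-1 z (w₁ ℕ.* (w₂ ℕ.* d))
    D≋ = 𝕊.reflexive (≡.cong (twistedExp-1 z) (≡.trans (≡.sym (ℕ.*-assoc w₂ w₁ d))
           (≡.trans (≡.cong (ℕ._* d) (ℕ.*-comm w₂ w₁)) (ℕ.*-assoc w₁ w₂ d))))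

  module QuotientSymmetry (χ : ℤ → Carrier) (d : ℕ)
    (periodic : ∀ a → χ (a ℤ.+ + d) ≈ χ a) (z : Carrier) where

    -- sᵈ e^{dt} - 1 is invertible, or it is t times an invertible series; in either
    -- case it divides t f for every series f.
    Divisible : Carrier → Set (ℓ₁ ⊔ ℓ₂)
    Divisible s = denom 0 # 0# ⊎ (denom 0 ≈ 0# × denom 1 # 0#)
      where denom = twistedExp-1 s d

    -- The quotient t ∑_{a<d} χ(a) sᵃ e^{at} / (sᵈ e^{dt} - 1), where sᵈ is an N-th
    -- root of unity.  The symmetry holds whichever N, proof of (sᵈ)ᴺ ≈ 1 and proofs
    -- of divisibility enter the division.  They are left variable so that the ones
    -- in generatingQuotient are found by unification, with no need to compare
    -- proofs of apartness.
    module _ (s : Carrier) (N : ℕ) .{{_ : NonZero N}} (root : (s ^ d) ^ N ≈ 1#)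
      (if≈1 : s ^ d ≈ 1# → Divisible s) (if#1 : s ^ d # 1# → Divisible s) where

      quotient : ∃[ G ] (G ⊛ twistedExp-1 s d ≋ t∙ twistedSum χ s d)
      quotient = divide-t∙ (twistedSum χ s d) (twistedExp-1 s d)
        ([ if≈1 , if#1 ]′ (rootOfUnity-≈1⊎#1 N (s ^ d) root))

      -- bernoulli k n x is the value at x of the n-th Bernoulli polynomial of order k
      -- with this generating quotient.
      bernoulli : ℕ → ℕ → Carrier → Carrier
      bernoulli k n x = ⟦ n ! ⟧ * (proj₁ quotient ^ˢ k ⊛ exp[ x ]) n

    bernoulliSymmetry : ∀ (w₁ w₂ : ℕ) .{{_ : NonZero w₁}} .{{_ : NonZero w₂}} m n x y
      {N₁} .{{_ : NonZero N₁}} {r₁ f₁ g₁} {N₂} .{{_ : NonZero N₂}} {r₂ f₂ g₂} →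
      let β₁ = bernoulli (z ^ w₁) N₁ r₁ f₁ g₁
          β₂ = bernoulli (z ^ w₂) N₂ r₂ f₂ g₂ in
      OneSide.side χ β₁ β₂ z w₁ w₂ x y (suc m) (w₁ ℕ.* d) n
      ≈ OneSide.side χ β₂ β₁ z w₂ w₁ x y (suc m) (w₂ ℕ.* d) n
    bernoulliSymmetry w₁ w₂ m n x y {N₁} {r₁} {f₁} {g₁} {N₂} {r₂} {f₂} {g₂} =
      side-symmetric χ d periodic z w₁ w₂ m n x y (proj₁ q₁) (proj₁ q₂)
        (λ _ _ _ → refl) (λ _ _ _ → refl) (proj₂ q₁) (proj₂ q₂)
      where
      q₁ = quotient (z ^ w₁) N₁ r₁ f₁ g₁
      q₂ = quotient (z ^ w₂) N₂ r₂ f₂ g₂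

theorem3 : {c ℓ₁ ℓ₂ : Level} {p : ℕ} (p-prime : Prime p) (ℂ : ComplexPAdicNumbers p c ℓ₁ ℓ₂) →
    let open TwistedBernoulli p-prime (ComplexPAdicNumbers.field-ℂₚ ℂ) (characteristicZero-ℂₚ ℂ) in
    (d w₁ w₂ : ℕ) .{{_ : NonZero d}} .{{_ : NonZero w₁}} .{{_ : NonZero w₂}}
    (X : DirichletCharacter (ComplexPAdicNumbers.field-ℂₚ ℂ) d) → DirichletCharacter.HasConductor X d →
    let open DirichletCharacter X using (χ) in
    (ξ : Tₚ) (n m : ℕ) .{{_ : NonZero m}} (x y : Carrier) →
    (∑[ k ≤ n ] (⟦ n C toℕ k ⟧ * w₁ ^ᶻ (toℕ k ⊖ 1) * ⟦ w₂ ⟧ ^ (n ∸ toℕ k)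
      * B X (ξ ^ᵀ w₂) (m ∸ 1) (n ∸ toℕ k) (⟦ w₁ ⟧ * y)
      * (∑[ i < w₁ ℕ.* d ] (χ (+ toℕ i) * value ξ ^ (w₂ ℕ.* toℕ i)
          * B X (ξ ^ᵀ w₁) m (toℕ k) (⟦ w₂ ⟧ * x + ⟦ w₂ ⟧ * (1/ w₁) * ⟦ toℕ i ⟧)))))
    ≈
    (∑[ k ≤ n ] (⟦ n C toℕ k ⟧ * w₂ ^ᶻ (toℕ k ⊖ 1) * ⟦ w₁ ⟧ ^ (n ∸ toℕ k)
      * B X (ξ ^ᵀ w₁) (m ∸ 1) (n ∸ toℕ k) (⟦ w₂ ⟧ * y)
      * (∑[ i < w₂ ℕ.* d ] (χ (+ toℕ i) * value ξ ^ (w₁ ℕ.* toℕ i)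
          * B X (ξ ^ᵀ w₂) m (toℕ k) (⟦ w₁ ⟧ * x + ⟦ w₁ ⟧ * (1/ w₂) * ⟦ toℕ i ⟧)))))
theorem3 {p = p} p-prime ℂ d w₁ w₂ X _ ξ n (suc m) x y = h
  where
  open TwistedBernoulli p-prime (ComplexPAdicNumbers.field-ℂₚ ℂ) (characteristicZero-ℂₚ ℂ)
  open SeriesAlgebra (ComplexPAdicNumbers.field-ℂₚ ℂ) (characteristicZero-ℂₚ ℂ)
  open DirichletCharacter X using (χ; periodic)
  -- The exponent N in generatingQuotient is a power pⁿ with ξ^{pⁿ} = 1.
  instance
    pⁿ≢0 : NonZero (p ℕ.^ Tₚ.exponent ξ)
    pⁿ≢0 = ℕ.m^n≢0 p (Tₚ.exponent ξ) {{prime⇒nonZero p-prime}}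
  h = QuotientSymmetry.bernoulliSymmetry χ d periodic (value ξ) w₁ w₂ m n x y
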